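{- For all positive integers $d$, $n$, and $a$, \begin{align*} h_d^{(a+1)}(n) & \leq h_d^{(a)}(n), \\ h_{d+1}^{(a)}(n) & \leq h_d^{(a)}(n), \\ h_d^{(a)}(n) & \leq h_d^{(a)}(n+1), \end{align*} and for all positive integers $d$, $n$, and $a$ with $a < \frac{d+3}{2}$, \begin{align*} \ell_d^{(a)}(n) &\leq \ell_d^{(a)}(n+1), \\ \ell_{d+1}^{(a)}(n) &\leq \ell_d^{(a)}(n). \end{align*}
   Context: A partition $\pi$ is a finite nonempty nonincreasing sequence of positive integers, called its parts. Its perimeter is (largest part of $\pi$) $+$ (number of parts of $\pi$) $-\,1$. A partition is $d$-distinct if any two consecutive parts $\pi_i\ge \pi_{i+1}$ satisfy $\pi_i-\pi_{i+1}\geq d$. For positive integers $n,a,d$: - $h_d^{(a)}(n)$ is the number of partitions with perimeter $n$ whose parts are $d$-distinct and all $\geq a$; - $\ell_d^{(a)}(n)$ is the number of partitions with perimeter $n$ all of whose parts are congruent to $a$ or $-a$ modulo $d+3$ (so $\ell_{d+1}^{(a)}(n)$ uses the modulus $d+4$). -}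

module Defs where

open import Data.Empty using (⊥-elim)
open import Data.Integer as ℤ using (ℤ; +_)
open import Data.List using (List; []; _∷_; length; filter; upTo; cartesianProductWith)
open import Data.List.Extrema.Nat using (max; xs≤max)
open import Data.List.Membership.Propositional using (_∈_)
open import Data.List.Membership.Propositional.Properties
  using (∈-filter⁺; ∈-filter⁻; ∈-cartesianProductWith⁺; ∈-cartesianProductWith⁻; ∈-upTo⁺)
open import Data.List.Properties using (∷-injective)
open import Data.List.Relation.Unary.All as All using (All; []; _∷_)
open import Data.List.Relation.Unary.AllPairs using ([]; _∷_)
open import Data.List.Relation.Unary.Any using (here; there)
open import Data.List.Relation.Unary.Linked as Linked using (Linked)
open import Data.List.Relation.Unary.Unique.Propositional using (Unique)
open import Data.List.Relation.Unary.Unique.Propositional.Properties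
  using (cartesianProductWith⁺; upTo⁺; filter⁺)
open import Data.Nat using (ℕ; zero; suc; _+_; _∸_; _≤_; _<_; _≥_; _≤?_; _<?_; _≥?_; _≟_; s≤s)
open import Data.Nat.Divisibility using (_∣?_)
open import Data.Nat.Properties
  using (≤-trans; m≤m+n; m≤n+m; +-suc; ≤-reflexive; +-monoˡ-≤)
open import Data.Product using (_×_; _,_; proj₂)
open import Data.Sum using (_⊎_)
open import Function.Bundles using (_⇔_; mk⇔)
open import Relation.Binary.PropositionalEquality using (_≡_; _≢_; refl)
open import Relation.Nullary using (Dec; yes; no; _×-dec_; _⊎-dec_)
open import Relation.Unary using (Pred; Decidable)
open import Level using (0ℓ)
import Data.Integer.Divisibility as ℤ∣

IsPartition : Pred (List ℕ) 0ℓ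
IsPartition π = π ≢ [] × All (0 <_) π × Linked _≥_ π

-- `max 0 π` is the largest part; the subtraction never truncates since π ≢ [].
perimeter : List ℕ → ℕ
perimeter π = max 0 π + length π ∸ 1

-- Only applied to nonincreasing lists, where x ∸ y is the true difference.
Distinct : ℕ → Pred (List ℕ) 0ℓ
Distinct d = Linked (λ x y → x ∸ y ≥ d)

_≡_mod_ : ℤ → ℤ → ℕ → Set
x ≡ y mod m = + m ℤ∣.∣ (x ℤ.- y)

CongruentTo± : ℕ → ℕ → Pred ℕ 0ℓ
CongruentTo± a m p = ((+ p) ≡ (+ a) mod m) ⊎ ((+ p) ≡ (ℤ.- (+ a)) mod m)

isPartition? : Decidable IsPartition
isPartition? π = nonEmpty? π ×-dec All.all? (0 <?_) π ×-dec Linked.linked? _≥?_ π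
  where
  nonEmpty? : Decidable (_≢ [])
  nonEmpty? []      = no λ []≢[] → []≢[] refl
  nonEmpty? (_ ∷ _) = yes λ ()

distinct? : ∀ d → Decidable (Distinct d)
distinct? d = Linked.linked? (λ x y → x ∸ y ≥? d)

mod? : ∀ x y m → Dec (x ≡ y mod m)
mod? x y m = m ∣? ℤ.∣ x ℤ.- y ∣

congruentTo±? : ∀ a m → Decidable (CongruentTo± a m)
congruentTo±? a m p = mod? (+ p) (+ a) m ⊎-dec mod? (+ p) (ℤ.- (+ a)) m

-- All lists of length at most k with entries at most b, each exactly once.
boundedLists : ℕ → ℕ → List (List ℕ)
boundedLists b zero    = [] ∷ []
boundedLists b (suc k) = [] ∷ cartesianProductWith _∷_ (upTo (suc b)) (boundedLists b k)

HasPerimeter : ℕ → Pred (List ℕ) 0ℓ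
HasPerimeter n π = IsPartition π × perimeter π ≡ n

hasPerimeter? : ∀ n → Decidable (HasPerimeter n)
hasPerimeter? n π = isPartition? π ×-dec perimeter π ≟ n

-- A partition of perimeter n has at most n parts, each at most n, so this
-- enumerates all of them; see ∈-partitions and partitions-unique below.
partitions : ℕ → List (List ℕ)
partitions n = filter (hasPerimeter? n) (boundedLists n n)

count : {P : Pred (List ℕ) 0ℓ} → Decidable P → ℕ → ℕ
count P? n = length (filter P? (partitions n))

h : (d a n : ℕ) → ℕ
h d a = count (λ π → distinct? d π ×-dec All.all? (a ≤?_) π)

ℓ : (d a n : ℕ) → ℕ
ℓ d a = count (All.all? (congruentTo±? a (d + 3)))

boundedLists-unique : ∀ b k → Unique (boundedLists b k)
boundedLists-unique b zero    = [] ∷ []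
boundedLists-unique b (suc k) =
  All.tabulate []≢ ∷
  cartesianProductWith⁺ _∷_ ∷-injective (upTo⁺ (suc b)) (boundedLists-unique b k)
  where
  []≢ : ∀ {xs} → xs ∈ cartesianProductWith _∷_ (upTo (suc b)) (boundedLists b k) → [] ≢ xs
  []≢ xs∈ refl with ∈-cartesianProductWith⁻ _∷_ (upTo (suc b)) (boundedLists b k) xs∈
  ... | _ , _ , _ , _ , ()

∈-boundedLists : ∀ {b k xs} → All (_≤ b) xs → length xs ≤ k → xs ∈ boundedLists b k
∈-boundedLists {k = zero}  []       _         = here refl
∈-boundedLists {k = suc k} []       _         = here refl
∈-boundedLists {k = suc k} (p ∷ ps) (s≤s len) =
  there (∈-cartesianProductWith⁺ _∷_ (∈-upTo⁺ (s≤s p)) (∈-boundedLists ps len))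

partitions-unique : ∀ n → Unique (partitions n)
partitions-unique n = filter⁺ (hasPerimeter? n) (boundedLists-unique n n)

∈-partitions : ∀ {n π} → π ∈ partitions n ⇔ HasPerimeter n π
∈-partitions {n} {π} = mk⇔ (λ π∈ → proj₂ (∈-filter⁻ (hasPerimeter? n) {xs = boundedLists n n} π∈)) from
  where
  bounds : ∀ π → IsPartition π → All (_≤ perimeter π) π × length π ≤ perimeter π
  bounds []           (ne , _)            = ⊥-elim (ne refl)
  bounds π@(p ∷ rest) (_ , (0<p ∷ _) , _) =
    All.map (λ q≤ → ≤-trans q≤ max≤) (xs≤max 0 π) , len≤
    where
    M+l = max 0 π + length rest
    per : M+l ≤ perimeter π
    per rewrite +-suc (max 0 π) (length rest) = ≤-reflexive refl
    max≤ : max 0 π ≤ perimeter π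
    max≤ = ≤-trans (m≤m+n (max 0 π) (length rest)) per
    len≤ : length π ≤ perimeter π
    len≤ = ≤-trans (+-monoˡ-≤ (length rest) (≤-trans 0<p (All.head (xs≤max 0 π)))) per
  from : HasPerimeter n π → π ∈ partitions n
  from hp@(isP , refl) with bounds π isP
  ... | parts≤ , len≤ = ∈-filter⁺ (hasPerimeter? n) (∈-boundedLists parts≤ len≤) hp

{-# OPTIONS --safe #-}

-- Each inequality comes from an injection between sets of partitions. Lowering
-- the bound on the parts or the required gap only enlarges the set; adding 1 to
-- the largest part, or duplicating it, raises the perimeter by 1.
--
-- For the last inequality put m = d + 3. A part p is admissible modulo m + 1 iff
-- p + a = s + c (m + 1) with s ∈ {0, 2a}, and then p − c is admissible modulo m,
-- as p − c + a = s + c m. Since 2a < m, c is the quotient in both divisions, so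
-- p can be recovered from p − c. Replacing every part p by p − c lowers the
-- largest part by its own quotient c, which is compensated by adding c further
-- copies of the new largest part.
module Submission where

open import Defs
open import Data.Empty using (⊥-elim)
open import Data.Fin using (Fin; zero; suc)
open import Data.Fin.Properties using (injective⇒≤)
import Data.Integer as ℤ
import Data.Integer.Properties as ℤ
open import Data.List using (List; []; _∷_; _++_; length; map; filter; lookup; drop; replicate)
open import Data.List.Extrema.Nat using (max; max≈v⁺)
open import Data.List.Membership.Propositional using (_∈_)
open import Data.List.Membership.Propositional.Properties using (∈-filter⁺; ∈-filter⁻; ∈-lookup)
open import Data.List.Properties using (length-++; length-replicate; length-map; map-∘; map-id-local)
open import Data.List.Relation.Unary.All as All using (All; []; _∷_)
import Data.List.Relation.Unary.All.Properties as All
open import Data.List.Relation.Unary.AllPairs using ([]; _∷_)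
open import Data.List.Relation.Unary.Any using (here; index)
open import Data.List.Relation.Unary.Any.Properties using (lookup-index)
open import Data.List.Relation.Unary.Linked as Linked using (Linked; [-]; _∷_)
import Data.List.Relation.Unary.Linked.Properties as Linked
open import Data.List.Relation.Unary.Unique.Propositional using (Unique)
open import Data.List.Relation.Unary.Unique.Propositional.Properties using (filter⁺)
open import Data.Nat
  using (ℕ; suc; _+_; _*_; _∸_; _/_; _≤_; _<_; _≥_; _≤?_; pred; z≤n; s≤s; NonZero; >-nonZero; >-nonZero⁻¹)
open import Data.Nat.Divisibility using (_∣_; divides; divides-refl; ∣⇒≤)
open import Data.Nat.DivMod using (+-distrib-/-∣ʳ; m<n⇒m/n≡0; m*n/n≡m; /-monoˡ-≤)
open import Data.Nat.Properties
open import Data.Nat.Tactic.RingSolver using (solve-∀)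
open import Data.Product using (∃-syntax; _×_; _,_; proj₁; proj₂)
open import Data.Sum using (inj₁; inj₂)
open import Function using (_∘_; id)
open import Function.Bundles using (Equivalence)
open import Level using (0ℓ)
open import Relation.Binary.PropositionalEquality
  using (_≡_; _≢_; refl; sym; trans; cong; cong₂; subst; module ≡-Reasoning)
open import Relation.Nullary using (yes; no; contradiction; _×-dec_)
open import Relation.Unary using (Pred; Decidable)

-- Comparing counts through maps with a left inverse.

private
  variable
    A B : Set

lookup-injective : {xs : List A} → Unique xs → ∀ {i j} → lookup xs i ≡ lookup xs j → i ≡ j
lookup-injective (_  ∷ _)  {zero}  {zero}  _  = refl
lookup-injective (x∉ ∷ _)  {zero}  {suc j} eq = contradiction eq (All.lookup x∉ (∈-lookup j))
lookup-injective (x∉ ∷ _)  {suc i} {zero}  eq = contradiction (sym eq) (All.lookup x∉ (∈-lookup i))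
lookup-injective (_  ∷ xs) {suc i} {suc j} eq = cong suc (lookup-injective xs eq)

-- Lists are compared through their positions: two entries of `xs` sent to the same position of `ys`
-- are equal after applying `g`, and uniqueness of `xs` then makes their positions equal.
retraction⇒length-≤ : {xs : List A} {ys : List B} (f : A → B) (g : B → A) → Unique xs →
                      (∀ {x} → x ∈ xs → f x ∈ ys × g (f x) ≡ x) → length xs ≤ length ys
retraction⇒length-≤ {xs = xs} {ys} f g xs! f∈ = injective⇒≤ λ {i} {j} → F-injective {i} {j}
  where
  F : Fin (length xs) → Fin (length ys)
  F i = index (proj₁ (f∈ (∈-lookup i)))

  g-lookup-F : ∀ i → g (lookup ys (F i)) ≡ lookup xs i
  g-lookup-F i with fx∈ys , gfx≡x ← f∈ (∈-lookup {xs = xs} i) =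
    trans (cong g (sym (lookup-index fx∈ys))) gfx≡x

  F-injective : ∀ {i j} → F i ≡ F j → i ≡ j
  F-injective {i} {j} eq = lookup-injective xs!
    (trans (sym (g-lookup-F i)) (trans (cong (g ∘ lookup ys) eq) (g-lookup-F j)))

-- The common form of all five inequalities. Only on the counted partitions must `g` undo `f`, so
-- both can be plain functions on lists with arbitrary values elsewhere.
count-≤ : {P Q : Pred (List ℕ) 0ℓ} (P? : Decidable P) (Q? : Decidable Q) (n n′ : ℕ)
          (f g : List ℕ → List ℕ) →
          (∀ {π} → HasPerimeter n π → P π → HasPerimeter n′ (f π) × Q (f π) × g (f π) ≡ π) →
          count P? n ≤ count Q? n′
count-≤ P? Q? n n′ f g maps =
  retraction⇒length-≤ f g (filter⁺ P? (partitions-unique n)) λ π∈ →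
    let π∈n , Pπ = ∈-filter⁻ P? {xs = partitions n} π∈
        hp , Qfπ , gf≡ = maps (Equivalence.to ∈-partitions π∈n) Pπ
    in ∈-filter⁺ Q? (Equivalence.from ∈-partitions hp) Qfπ , gf≡

-- In a nonincreasing list the head is the maximum, and the subtracted 1 cancels the head's own
-- contribution to the length.
perimeter-∷ : ∀ {p π} → Linked _≥_ (p ∷ π) → perimeter (p ∷ π) ≡ p + length π
perimeter-∷ {p} {π} p≥π = begin
  max 0 (p ∷ π) + suc (length π) ∸ 1 ≡⟨ cong (λ x → x + suc (length π) ∸ 1) max≡p ⟩
  p + suc (length π) ∸ 1             ≡⟨ cong (_∸ 1) (+-suc p (length π)) ⟩
  p + length π                       ∎
  where
  open ≡-Reasoning
  max≡p : max 0 (p ∷ π) ≡ p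
  max≡p = max≈v⁺ (here refl) (Linked.Linked⇒All (λ p≥q q≥r → ≤-trans q≥r p≥q) ≤-refl p≥π) z≤n

-- The three inequalities for `h`.

distinctLarge? : ∀ d a → Decidable (λ π → Distinct d π × All (a ≤_) π)
distinctLarge? d a π = distinct? d π ×-dec All.all? (a ≤?_) π

h-least-part-antitone : ∀ d a n → h d (a + 1) n ≤ h d a n
h-least-part-antitone d a n =
  count-≤ (distinctLarge? d (a + 1)) (distinctLarge? d a) n n id id λ hp (dist , large) →
    hp , (dist , All.map (≤-trans (m≤m+n a 1)) large) , refl

h-gap-antitone : ∀ d a n → h (d + 1) a n ≤ h d a n
h-gap-antitone d a n =
  count-≤ (distinctLarge? (d + 1) a) (distinctLarge? d a) n n id id λ hp (dist , large) →
    hp , (Linked.map (≤-trans (m≤m+n d 1)) dist , large) , refl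

mapHead : (ℕ → ℕ) → List ℕ → List ℕ
mapHead f []      = []
mapHead f (p ∷ π) = f p ∷ π

h-perimeter-monotone : ∀ d a n → h d a n ≤ h d a (n + 1)
h-perimeter-monotone d a n =
  count-≤ (distinctLarge? d a) (distinctLarge? d a) n (n + 1) (mapHead suc) (mapHead pred) maps
  where
  -- Only the first comparison involves the head. The relation is kept general to serve both `_≥_`
  -- and the gap condition.
  Linked-mapHead-suc : ∀ {R : ℕ → ℕ → Set} {p π} → (∀ {x y} → R x y → R (suc x) y) →
                       Linked R (p ∷ π) → Linked R (suc p ∷ π)
  Linked-mapHead-suc _   [-]      = [-]
  Linked-mapHead-suc up (r ∷ rs) = up r ∷ rs

  maps : ∀ {π} → HasPerimeter n π → Distinct d π × All (a ≤_) π →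
         HasPerimeter (n + 1) (mapHead suc π) ×
         (Distinct d (mapHead suc π) × All (a ≤_) (mapHead suc π)) ×
         mapHead pred (mapHead suc π) ≡ π
  maps {[]}    ((ne , _) , _) _ = ⊥-elim (ne refl)
  maps {p ∷ π} ((_ , 0<p ∷ 0<π , p≥π) , refl) (dist , a≤p ∷ a≤π) =
    (((λ ()) , s≤s z≤n ∷ 0<π , sp≥π) ,
      trans (perimeter-∷ sp≥π) (trans (cong suc (sym (perimeter-∷ p≥π))) (+-comm 1 _))) ,
    (Linked-mapHead-suc (λ {x} {y} d≤ → ≤-trans d≤ (∸-monoˡ-≤ y (n≤1+n x))) dist ,
     m≤n⇒m≤1+n a≤p ∷ a≤π) ,
    refl
    where
    sp≥π : Linked _≥_ (suc p ∷ π)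
    sp≥π = Linked-mapHead-suc m≤n⇒m≤1+n p≥π

-- Repeating the largest part, and monotonicity of `ℓ` in the perimeter.

repeatHead : ℕ → ℕ → List ℕ → List ℕ
repeatHead k p π = replicate k p ++ p ∷ π

-- Extra copies in front let `drop k` undo the repetition; this second shape exposes the head for a
-- variable `k`, as `perimeter-∷` and `expandParts` require.
repeatHead-∷ : ∀ k p π → repeatHead k p π ≡ p ∷ (replicate k p ++ π)
repeatHead-∷ 0       p π = refl
repeatHead-∷ (suc k) p π = cong (p ∷_) (repeatHead-∷ k p π)

drop-replicate-++ : ∀ k (x : A) xs → drop k (replicate k x ++ xs) ≡ xs
drop-replicate-++ 0       x xs = refl
drop-replicate-++ (suc k) x xs = drop-replicate-++ k x xs

repeatHead-isPartition : ∀ k {p π} → IsPartition (p ∷ π) → IsPartition (repeatHead k p π)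
repeatHead-isPartition k {p} {π} (_ , 0<p ∷ 0<π , p≥π) =
  nonEmpty k , All.++⁺ (All.replicate⁺ k 0<p) (0<p ∷ 0<π) , linked k
  where
  nonEmpty : ∀ k → repeatHead k p π ≢ []
  nonEmpty 0       ()
  nonEmpty (suc k) ()

  linked : ∀ k → Linked _≥_ (repeatHead k p π)
  linked 0             = p≥π
  linked 1             = ≤-refl ∷ p≥π
  linked (suc (suc k)) = ≤-refl ∷ linked (suc k)

repeatHead-perimeter : ∀ k {p π} → IsPartition (p ∷ π) →
                       perimeter (repeatHead k p π) ≡ k + (p + length π)
repeatHead-perimeter k {p} {π} isP = begin
  perimeter (repeatHead k p π)         ≡⟨ cong perimeter (repeatHead-∷ k p π) ⟩
  perimeter (p ∷ (replicate k p ++ π)) ≡⟨ perimeter-∷ nonincreasing ⟩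
  p + length (replicate k p ++ π)      ≡⟨ cong (λ x → p + x) (length-++ (replicate k p)) ⟩
  p + (length (replicate k p) + length π) ≡⟨ cong (λ x → p + (x + length π)) (length-replicate k) ⟩
  p + (k + length π)                   ≡⟨ swap p k (length π) ⟩
  k + (p + length π)                   ∎
  where
  open ≡-Reasoning
  nonincreasing : Linked _≥_ (p ∷ (replicate k p ++ π))
  nonincreasing = subst (Linked _≥_) (repeatHead-∷ k p π)
                    (proj₂ (proj₂ (repeatHead-isPartition k isP)))
  swap : ∀ x y z → x + (y + z) ≡ y + (x + z)
  swap = solve-∀

ℓ-perimeter-monotone : ∀ d a n → ℓ d a n ≤ ℓ d a (n + 1)
ℓ-perimeter-monotone d a n =
  count-≤ (All.all? (congruentTo±? a (d + 3))) (All.all? (congruentTo±? a (d + 3)))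
    n (n + 1) duplicate (drop 1) maps
  where
  duplicate : List ℕ → List ℕ
  duplicate []      = []
  duplicate (p ∷ π) = repeatHead 1 p π

  maps : ∀ {π} → HasPerimeter n π → All (CongruentTo± a (d + 3)) π →
         HasPerimeter (n + 1) (duplicate π) × All (CongruentTo± a (d + 3)) (duplicate π) ×
         drop 1 (duplicate π) ≡ π
  maps {[]}    ((ne , _) , _) _ = ⊥-elim (ne refl)
  maps {p ∷ π} (isP@(_ , _ , p≥π) , refl) (p≡ ∷ π≡) =
    (repeatHead-isPartition 1 isP ,
     trans (repeatHead-perimeter 1 isP)
       (trans (cong suc (sym (perimeter-∷ p≥π))) (+-comm 1 _))) ,
    p≡ ∷ p≡ ∷ π≡ ,
    refl

-- Residues `a` and `-a` in terms of quotients.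

-- Congruence up to sign in ℕ, shifted by a so that no subtraction occurs.
data Shifted± (a m p c : ℕ) : Set where
  minus : p + a ≡ c * m → Shifted± a m p c
  plus  : p + a ≡ 2 * a + c * m → Shifted± a m p c

∣p--a∣≡p+a : ∀ p a → ℤ.∣ (ℤ.+ p) ℤ.- (ℤ.- (ℤ.+ a)) ∣ ≡ p + a
∣p--a∣≡p+a p a = cong (λ x → ℤ.∣ ℤ.+ p ℤ.+ x ∣) (ℤ.neg-involutive (ℤ.+ a))

∣p-a∣≡∣p⊖a∣ : ∀ p a → ℤ.∣ (ℤ.+ p) ℤ.- (ℤ.+ a) ∣ ≡ ℤ.∣ p ℤ.⊖ a ∣
∣p-a∣≡∣p⊖a∣ p a = cong ℤ.∣_∣ (ℤ.m-n≡m⊖n p a)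

a<m : ∀ {a m} → 2 * a < m → a < m
a<m {a} = ≤-<-trans (m≤m+n a _)

CongruentTo±⇒Shifted± : ∀ {a m p} → 2 * a < m → CongruentTo± a m p → ∃[ c ] Shifted± a m p c
CongruentTo±⇒Shifted± {a} {m} {p} 2a<m (inj₂ m∣)
  with divides c eq ← subst (m ∣_) (∣p--a∣≡p+a p a) m∣ = c , minus eq
CongruentTo±⇒Shifted± {a} {m} {p} 2a<m (inj₁ m∣′)
  with m∣ ← subst (m ∣_) (∣p-a∣≡∣p⊖a∣ p a) m∣′ | a ≤? p
... | yes a≤p with divides c eq ← subst (m ∣_) (cong ℤ.∣_∣ (ℤ.⊖-≥ a≤p)) m∣ = c , plus (begin
  p + a             ≡⟨ cong (_+ a) (m∸n+n≡m a≤p) ⟨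
  p ∸ a + a + a     ≡⟨ cong (λ x → x + a + a) eq ⟩
  c * m + a + a     ≡⟨ rearrange (c * m) a ⟩
  2 * a + c * m     ∎)
  where
  open ≡-Reasoning
  rearrange : ∀ x a → x + a + a ≡ 2 * a + x
  rearrange = solve-∀
-- If `p < a`, then `m` divides the positive number `a ∸ p`, which is at most `a` and hence less
-- than `m`.
... | no a≰p = contradiction (≤-trans m≤a∸p (m∸n≤m a p)) (<⇒≱ (a<m 2a<m))
  where
  m≤a∸p : m ≤ a ∸ p
  m≤a∸p = ∣⇒≤ {{>-nonZero (m<n⇒0<n∸m (≰⇒> a≰p))}} (subst (m ∣_) (ℤ.∣⊖∣-≰ a≰p) m∣)

Shifted±⇒CongruentTo± : ∀ {a m p c} → Shifted± a m p c → CongruentTo± a m p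
Shifted±⇒CongruentTo± {a} {m} {p} {c} (minus eq) =
  inj₂ (subst (m ∣_) (sym (∣p--a∣≡p+a p a)) (divides c eq))
Shifted±⇒CongruentTo± {a} {m} {p} {c} (plus eq) = inj₁ (divides c (begin
  ℤ.∣ (ℤ.+ p) ℤ.- (ℤ.+ a) ∣   ≡⟨ ∣p-a∣≡∣p⊖a∣ p a ⟩
  ℤ.∣ p ℤ.⊖ a ∣           ≡⟨ cong (λ x → ℤ.∣ x ℤ.⊖ a ∣) p≡ ⟩
  ℤ.∣ a + c * m ℤ.⊖ a ∣   ≡⟨ cong ℤ.∣_∣ (ℤ.⊖-≥ (m≤m+n a (c * m))) ⟩
  a + c * m ∸ a           ≡⟨ m+n∸m≡n a (c * m) ⟩
  c * m                   ∎))
  where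
  open ≡-Reasoning
  rearrange : ∀ a x → 2 * a + x ≡ a + x + a
  rearrange = solve-∀
  p≡ : p ≡ a + c * m
  p≡ = +-cancelʳ-≡ a p (a + c * m) (trans eq (rearrange a (c * m)))

[s+cm]/m≡c : ∀ {s m} c .{{_ : NonZero m}} → s < m → (s + c * m) / m ≡ c
[s+cm]/m≡c {s} {m} c s<m = begin
  (s + c * m) / m   ≡⟨ +-distrib-/-∣ʳ s (divides-refl c) ⟩
  s / m + c * m / m ≡⟨ cong₂ _+_ (m<n⇒m/n≡0 s<m) (m*n/n≡m c m) ⟩
  c                 ∎
  where open ≡-Reasoning

-- Both shifts 0 and `2 * a` are remainders below `m`, so one division finds `c` without knowing the
-- sign of the residue.
Shifted±⇒/≡ : ∀ {a m p c} .{{_ : NonZero m}} → 2 * a < m → Shifted± a m p c → (p + a) / m ≡ c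
Shifted±⇒/≡ {c = c} 2a<m (minus eq) = trans (cong (_/ _) eq) (m*n/n≡m c _)
Shifted±⇒/≡ {c = c} 2a<m (plus eq) = trans (cong (_/ _) eq) ([s+cm]/m≡c c 2a<m)

-- Compression of a single part.

compress : (a m p : ℕ) → ℕ
compress a m p = p ∸ (p + a) / suc m

-- Division by `m` here matches division by `suc m` in `compress`: for an admissible part and its
-- compressed form, both quotients are the same `c`.
expand : (a m : ℕ) .{{_ : NonZero m}} → ℕ → ℕ
expand a m t = t + (t + a) / m

-- Raising `p` by `k` raises the quotient by at most `k`, because `k ≤ k * suc m`. Hence compressed
-- parts stay in nonincreasing order.
compress-mono-≤ : ∀ a m {p q} → p ≤ q → compress a m p ≤ compress a m q
compress-mono-≤ a m {p} {q} p≤q with k , refl ← m≤n⇒∃[o]m+o≡n p≤q = begin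
  p ∸ c               ≡⟨ [m+n]∸[m+o]≡n∸o k p c ⟨
  (k + p) ∸ (k + c)   ≡⟨ cong₂ _∸_ (+-comm k p) (+-comm k c) ⟩
  (p + k) ∸ (c + k)   ≤⟨ ∸-monoʳ-≤ (p + k) quotient-≤ ⟩
  (p + k) ∸ (p + k + a) / suc m ∎
  where
  open ≤-Reasoning
  c = (p + a) / suc m
  swap : ∀ x y z → x + y + z ≡ x + z + y
  swap = solve-∀
  quotient-≤ : (p + k + a) / suc m ≤ c + k
  quotient-≤ = begin
    (p + k + a) / suc m             ≡⟨ cong (_/ suc m) (swap p k a) ⟩
    (p + a + k) / suc m             ≤⟨ /-monoˡ-≤ (suc m) (+-monoʳ-≤ (p + a) (m≤m*n k (suc m))) ⟩
    (p + a + k * suc m) / suc m     ≡⟨ +-distrib-/-∣ʳ (p + a) (divides-refl k) ⟩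
    (p + a) / suc m + k * suc m / suc m ≡⟨ cong (λ x → c + x) (m*n/n≡m k (suc m)) ⟩
    c + k                           ∎

module _ {a m : ℕ} .{{_ : NonZero m}} (0<a : 0 < a) (2a<m : 2 * a < m) where

  Shifted±-compress : ∀ {p c} → 0 < p → Shifted± a (suc m) p c →
                      ∃[ t ] 0 < t × p ≡ c + t × Shifted± a m t c
  Shifted±-compress {p} {c} 0<p (minus eq) = t , m<n⇒0<n∸m a<cm , p≡ , minus t+a≡
    where
    -- A zero `c` would force `p` to be 0. Hence `c * m ≥ m > a`, and `c * m ∸ a` neither truncates
    -- nor vanishes.
    c-pos : ∀ c → p + a ≡ c * suc m → m ≤ c * m
    c-pos 0       eq = contradiction (m+n≡0⇒m≡0 p eq) (m<n⇒n≢0 0<p)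
    c-pos (suc c) _  = m≤m+n m (c * m)
    a<cm : a < c * m
    a<cm = <-≤-trans (a<m 2a<m) (c-pos c eq)
    t = c * m ∸ a
    t+a≡ : t + a ≡ c * m
    t+a≡ = m∸n+n≡m (<⇒≤ a<cm)
    p≡ : p ≡ c + t
    p≡ = +-cancelʳ-≡ a p (c + t) (begin
      p + a       ≡⟨ eq ⟩
      c * suc m   ≡⟨ *-suc c m ⟩
      c + c * m   ≡⟨ cong (λ x → c + x) t+a≡ ⟨
      c + (t + a) ≡⟨ +-assoc c t a ⟨
      c + t + a   ∎)
      where open ≡-Reasoning
  Shifted±-compress {p} {c} 0<p (plus eq) =
    -- Here `c` is 0 when `p` equals `a`; the new part is then `a` itself, positive by `0<a`.
    a + c * m , ≤-trans 0<a (m≤m+n a (c * m)) ,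
    +-cancelʳ-≡ a p _ (trans eq (rearrange₁ a c m)) , plus (rearrange₂ a (c * m))
    where
    rearrange₁ : ∀ a c m → 2 * a + c * suc m ≡ c + (a + c * m) + a
    rearrange₁ = solve-∀
    rearrange₂ : ∀ a x → a + x + a ≡ 2 * a + x
    rearrange₂ = solve-∀

  -- `difference` says that the subtraction in `compress` does not truncate, which balances the
  -- perimeter; `quotient` lets `c` be read off the compressed part, which makes `expand` an
  -- inverse.
  record Compressed (p : ℕ) : Set where
    field
      positive   : 0 < compress a m p
      congruent  : CongruentTo± a m (compress a m p)
      quotient   : (compress a m p + a) / m ≡ (p + a) / suc m
      difference : (p + a) / suc m + compress a m p ≡ p

    expand-compress : expand a m (compress a m p) ≡ p
    expand-compress = trans (cong (λ x → compress a m p + x) quotient) (trans (+-comm (compress a m p) _) difference)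

  open Compressed

  compressed : ∀ {p} → 0 < p → CongruentTo± a (suc m) p → Compressed p
  compressed {p} 0<p p≡±a
    with c , shifted ← CongruentTo±⇒Shifted± (m<n⇒m<1+n 2a<m) p≡±a
    with t , 0<t , p≡c+t , shifted′ ← Shifted±-compress 0<p shifted = record
    { positive   = subst (0 <_) t≡ 0<t
    ; congruent  = subst (CongruentTo± a m) t≡ (Shifted±⇒CongruentTo± shifted′)
    ; quotient   = trans (cong (λ x → (x + a) / m) (sym t≡))
                     (trans (Shifted±⇒/≡ 2a<m shifted′) (sym q≡c))
    ; difference = trans (cong₂ _+_ q≡c (sym t≡)) (sym p≡c+t)
    }
    where
    q≡c : (p + a) / suc m ≡ c
    q≡c = Shifted±⇒/≡ (m<n⇒m<1+n 2a<m) shifted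
    t≡ : t ≡ compress a m p
    t≡ = sym (trans (cong₂ _∸_ p≡c+t q≡c) (m+n∸m≡n c t))

  -- Compression of a whole partition.

  compressParts : List ℕ → List ℕ
  compressParts []      = []
  compressParts (p ∷ π) = repeatHead ((p + a) / suc m) (compress a m p) (map (compress a m) π)

  -- The number of added copies is recovered from the head alone, since its quotient by `m` is that
  -- of the original largest part by `suc m`.
  expandParts : List ℕ → List ℕ
  expandParts []      = []
  expandParts (t ∷ τ) = map (expand a m) (drop ((t + a) / m) (t ∷ τ))

  map-expand-compress : ∀ {π} → All Compressed π → map (expand a m) (map (compress a m) π) ≡ π
  map-expand-compress {π} cs =
    trans (sym (map-∘ π)) (map-id-local (All.map expand-compress cs))

  expandParts-compressParts : ∀ {π} → All Compressed π → expandParts (compressParts π) ≡ π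
  expandParts-compressParts []       = refl
  expandParts-compressParts {p ∷ π} (c ∷ cs) = begin
    expandParts (repeatHead k t τ)
      ≡⟨ cong expandParts (repeatHead-∷ k t τ) ⟩
    map (expand a m) (drop ((t + a) / m) (t ∷ (replicate k t ++ τ)))
      ≡⟨ cong₂ (λ x xs → map (expand a m) (drop x xs)) (quotient c) (sym (repeatHead-∷ k t τ)) ⟩
    map (expand a m) (drop k (repeatHead k t τ))
      ≡⟨ cong (map (expand a m)) (drop-replicate-++ k t (t ∷ τ)) ⟩
    map (expand a m) (t ∷ τ)
      ≡⟨ map-expand-compress (c ∷ cs) ⟩
    p ∷ π ∎
    where
    open ≡-Reasoning
    k = (p + a) / suc m
    t = compress a m p
    τ = map (compress a m) π

  compressParts-hasPerimeter : ∀ {n π} → HasPerimeter n π → All Compressed π →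
                               HasPerimeter n (compressParts π)
  compressParts-hasPerimeter {π = []}    hp _ = hp
  compressParts-hasPerimeter {π = p ∷ π} ((_ , _ , p≥π) , refl) (c ∷ cs) =
    repeatHead-isPartition k isP , (begin
      perimeter (repeatHead k t τ) ≡⟨ repeatHead-perimeter k isP ⟩
      k + (t + length τ)           ≡⟨ +-assoc k t (length τ) ⟨
      k + t + length τ             ≡⟨ cong₂ _+_ (difference c) (length-map (compress a m) π) ⟩
      p + length π                 ≡⟨ perimeter-∷ p≥π ⟨
      perimeter (p ∷ π)            ∎)
    where
    open ≡-Reasoning
    k = (p + a) / suc m
    t = compress a m p
    τ = map (compress a m) π
    isP : IsPartition (t ∷ τ)
    isP = (λ ()) , All.map⁺ (All.map positive (c ∷ cs)) ,
          Linked.map⁺ (Linked.map (compress-mono-≤ a m) p≥π)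

  compressParts-congruent : ∀ {π} → All Compressed π → All (CongruentTo± a m) (compressParts π)
  compressParts-congruent []                 = []
  compressParts-congruent {p ∷ π} (c ∷ cs) =
    All.++⁺ (All.replicate⁺ ((p + a) / suc m) (congruent c))
            (All.map⁺ (All.map congruent (c ∷ cs)))

  count-congruent-antitone : ∀ n → count (All.all? (congruentTo±? a (suc m))) n ≤
                                   count (All.all? (congruentTo±? a m)) n
  count-congruent-antitone n =
    count-≤ (All.all? (congruentTo±? a (suc m))) (All.all? (congruentTo±? a m))
      n n compressParts expandParts λ hp@((_ , 0<π , _) , _) π≡ →
    let cs = All.zipWith (λ (0<p , p≡) → compressed 0<p p≡) (0<π , π≡)
    in compressParts-hasPerimeter hp cs , compressParts-congruent cs , expandParts-compressParts cs

ℓ-modulus-antitone : ∀ d a n → 0 < a → 2 * a < d + 3 → ℓ (d + 1) a n ≤ ℓ d a n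
-- After the rewrite the modulus `d + 1 + 3` computes to `suc (d + 3)`.
ℓ-modulus-antitone d a n 0<a 2a<m rewrite +-comm d 1 =
  count-congruent-antitone {{>-nonZero (≤-<-trans z≤n 2a<m)}} 0<a 2a<m n

proposition1p6 : (∀ (d n a : ℕ) .{{_ : NonZero d}} .{{_ : NonZero n}} .{{_ : NonZero a}} →
    (h d (a + 1) n ≤ h d a n)
    × (h (d + 1) a n ≤ h d a n)
    × (h d a n ≤ h d a (n + 1)))
    ×
    (∀ (d n a : ℕ) .{{_ : NonZero d}} .{{_ : NonZero n}} .{{_ : NonZero a}} →
    2 * a < d + 3 →
    (ℓ d a n ≤ ℓ d a (n + 1))
    × (ℓ (d + 1) a n ≤ ℓ d a n))
proposition1p6 =
  (λ d n a → h-least-part-antitone d a n , h-gap-antitone d a n , h-perimeter-monotone d a n) ,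
  (λ d n a 2a<m → ℓ-perimeter-monotone d a n ,
                  ℓ-modulus-antitone d a n (>-nonZero⁻¹ a) 2a<m)
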